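{- Let $G$ be a finite digraph without sources that has a good quasi-kernel. Then $G$ has a quasi-kernel with at most $|V(G)|/2$ vertices.
   Context: Digraphs are finite, without loops and without multiple edges in the same direction; anti-parallel edges are allowed. For $V'\subseteq V(G)$, $\Gamma^+(V')$ is the set of out-neighbours of vertices of $V'$, $\Gamma^+_2(V')=V'\cup\Gamma^+(V')\cup\Gamma^+(\Gamma^+(V'))$. A source is a vertex of in-degree $0$. A quasi-kernel is an independent set $Q$ with $\Gamma^+_2(Q)=V(G)$. A quasi-kernel $Q$ is good if $Q\subseteq\Gamma^+(\Gamma^+(Q))$. -}

module Defs where

open import Data.Fin using (Fin)
open import Data.Fin.Subset using (Subset; ∣_∣) renaming (_∈_ to _∈ₛ_; _∉_ to _∉ₛ_)
open import Data.Nat using (ℕ)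
open import Data.Product using (_×_; ∃-syntax)
open import Data.Vec using (lookup; tabulate)
open import Level using (0ℓ)
open import Relation.Binary.PropositionalEquality using (_≡_)
open import Relation.Nullary using (¬_)
open import Relation.Unary using (Pred; _∈_; _∪_; _⊆_; _≐_; U)

-- Storing the out-neighbours of each vertex as a set rules out multiple arcs
-- in the same direction; anti-parallel arcs are unrestricted.
record Digraph : Set where
  field
    order    : ℕ
    out      : Fin order → Subset order
    loopless : ∀ v → v ∉ₛ out v

  Vertex : Set
  Vertex = Fin order

  infix 4 _⟶_
  _⟶_ : Vertex → Vertex → Set
  u ⟶ v = v ∈ₛ out u

  inNeighbours : Vertex → Subset order
  inNeighbours v = tabulate (λ u → lookup (out u) v)

  inDegree : Vertex → ℕ
  inDegree v = ∣ inNeighbours v ∣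

  IsSource : Vertex → Set
  IsSource v = inDegree v ≡ 0

  Sourceless : Set
  Sourceless = ∀ v → ¬ IsSource v

  Γ⁺ : Pred Vertex 0ℓ → Pred Vertex 0ℓ
  Γ⁺ S v = ∃[ u ] (u ∈ S × u ⟶ v)

  Γ₂⁺ : Pred Vertex 0ℓ → Pred Vertex 0ℓ
  Γ₂⁺ S = S ∪ (Γ⁺ S ∪ Γ⁺ (Γ⁺ S))

  ⟦_⟧ : Subset order → Pred Vertex 0ℓ
  ⟦ Q ⟧ v = v ∈ₛ Q

  Independent : Subset order → Set
  Independent Q = ∀ {u v} → u ∈ₛ Q → v ∈ₛ Q → ¬ (u ⟶ v)

  record IsQuasiKernel (Q : Subset order) : Set where
    field
      independent : Independent Q
      covers      : Γ₂⁺ ⟦ Q ⟧ ≐ U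

  record IsGoodQuasiKernel (Q : Subset order) : Set where
    field
      isQuasiKernel : IsQuasiKernel Q
      good          : ⟦ Q ⟧ ⊆ Γ⁺ (Γ⁺ ⟦ Q ⟧)

{-# OPTIONS --safe #-}
-- Let Q be a good quasi-kernel and N = Γ⁺(Q). Independence makes Q and N disjoint, and
-- goodness together with covering says that Γ⁺(N) contains every vertex outside N, those of
-- Q included. So any Q′ ⊆ Q with Γ⁺(Q′) ⊇ N is again a quasi-kernel. Choosing one
-- in-neighbour in Q for each vertex of N gives such a Q′ with |Q′| ≤ |N|; as also |Q′| ≤ |Q|,
-- disjointness yields 2|Q′| ≤ |V|.
module Submission where

open import Defs
open import Data.Fin using (Fin; zero; suc)
open import Data.Fin.Properties using (any?)
open import Data.Fin.Subset
  using (Subset; inside; outside; _∈_; _∉_; _⊆_; _∪_; ∁; ⊥; ⁅_⁆)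
open import Data.Fin.Subset using (∣_∣)
open import Data.Fin.Subset.Properties
  using (_∈?_; ∉⊥; ∣⊥∣≡0; x∈⁅x⁆; x∈⁅y⁆⇒x≡y; ∣⁅x⁆∣≡1; x∈p∪q⁻; x∈p∪q⁺; p⊆q⇒∣p∣≤∣q∣;
         x∉p⇒x∈∁p; ∣∁p∣≡n∸∣p∣; ∣p∣≤n)
open import Data.Nat using (zero; suc; _+_; _∸_; z≤n; s≤s)
open import Data.Nat using (_*_; _≤_)
open import Data.Nat.Properties
  using (≤-reflexive; m≤n⇒m≤1+n; +-suc; +-identityʳ; +-mono-≤; +-monoʳ-≤; m+[n∸m]≡n;
         module ≤-Reasoning)
open import Data.Product using (_×_; ∃-syntax)
open import Data.Product using (_,_; proj₂)
open import Data.Sum using (inj₁; inj₂)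
open import Data.Unit using (tt)
open import Data.Vec using ([]; _∷_; here; there)
open import Relation.Binary using (REL; Decidable)
open import Relation.Binary.PropositionalEquality using (cong; refl)
open import Relation.Nullary using (yes; no; contradiction; _×-dec_)

∣p∪q∣≤∣p∣+∣q∣ : ∀ {n} (p q : Subset n) → ∣ p ∪ q ∣ ≤ ∣ p ∣ + ∣ q ∣
∣p∪q∣≤∣p∣+∣q∣ []            []            = z≤n
∣p∪q∣≤∣p∣+∣q∣ (outside ∷ p) (outside ∷ q) = ∣p∪q∣≤∣p∣+∣q∣ p q
∣p∪q∣≤∣p∣+∣q∣ (inside  ∷ p) (outside ∷ q) = s≤s (∣p∪q∣≤∣p∣+∣q∣ p q)
∣p∪q∣≤∣p∣+∣q∣ (outside ∷ p) (inside  ∷ q) rewrite +-suc ∣ p ∣ ∣ q ∣ =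
  s≤s (∣p∪q∣≤∣p∣+∣q∣ p q)
∣p∪q∣≤∣p∣+∣q∣ (inside  ∷ p) (inside  ∷ q) rewrite +-suc ∣ p ∣ ∣ q ∣ =
  s≤s (m≤n⇒m≤1+n (∣p∪q∣≤∣p∣+∣q∣ p q))

disjoint⇒∣p∣+∣q∣≤n : ∀ {n} {p q : Subset n} → (∀ {x} → x ∈ p → x ∉ q) →
                     ∣ p ∣ + ∣ q ∣ ≤ n
disjoint⇒∣p∣+∣q∣≤n {n} {p} {q} disjoint = begin
  ∣ p ∣ + ∣ q ∣       ≤⟨ +-monoʳ-≤ ∣ p ∣ (p⊆q⇒∣p∣≤∣q∣ q⊆∁p) ⟩
  ∣ p ∣ + ∣ ∁ p ∣     ≡⟨ cong (∣ p ∣ +_) (∣∁p∣≡n∸∣p∣ p) ⟩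
  ∣ p ∣ + (n ∸ ∣ p ∣) ≡⟨ m+[n∸m]≡n (∣p∣≤n p) ⟩
  n                   ∎
  where
  open ≤-Reasoning

  q⊆∁p : q ⊆ ∁ p
  q⊆∁p x∈q = x∉p⇒x∈∁p λ x∈p → disjoint x∈p x∈q

-- A choice function for `R`, recorded only through its effect: every related `x` keeps some partner
-- inside `targets`. Different `x` may share a partner, hence an inequality in `size`.
record Representatives {m n ℓ} (R : REL (Fin m) (Fin n) ℓ) : Set ℓ where
  field
    sources   : Subset m
    targets   : Subset n
    size      : ∣ targets ∣ ≤ ∣ sources ∣
    ∈sources⁻ : ∀ {x} → x ∈ sources → ∃[ y ] R x y
    ∈targets⁻ : ∀ {y} → y ∈ targets → ∃[ x ] R x y
    represent : ∀ {x y} → R x y → ∃[ z ] (z ∈ targets × R x z)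

-- Induction on `m`: if `zero` has a partner, one such `y` joins `targets` and `zero` joins
-- `sources`; otherwise both sets stay as they were.
representatives : ∀ {m n ℓ} {R : REL (Fin m) (Fin n) ℓ} → Decidable R → Representatives R
representatives {zero} {n} R? = record
  { sources   = []
  ; targets   = ⊥
  ; size      = ≤-reflexive (∣⊥∣≡0 n)
  ; ∈sources⁻ = λ ()
  ; ∈targets⁻ = λ y∈⊥ → contradiction y∈⊥ ∉⊥
  ; represent = λ { {()} }
  }
representatives {suc m} {n} {R = R} R? with representatives (λ x → R? (suc x)) | any? (R? zero)
... | rec | no ∄y = record
  { sources   = outside ∷ sources
  ; targets   = targets
  ; size      = size
  ; ∈sources⁻ = λ { (there x∈s) → ∈sources⁻ x∈s }
  ; ∈targets⁻ = λ y∈t → let x , Rxy = ∈targets⁻ y∈t in suc x , Rxy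
  ; represent = λ { {zero} Rxy → contradiction (_ , Rxy) ∄y ; {suc x} Rxy → represent Rxy }
  }
  where open Representatives rec
... | rec | yes (y , R0y) = record
  { sources   = inside ∷ sources
  ; targets   = ⁅ y ⁆ ∪ targets
  ; size      = size′
  ; ∈sources⁻ = λ { here → y , R0y ; (there x∈s) → ∈sources⁻ x∈s }
  ; ∈targets⁻ = ∈targets′⁻
  ; represent = represent′
  }
  where
  open Representatives rec

  -- The new `y` may already lie in `targets`, whereas `sources` grows by exactly one.
  size′ : ∣ ⁅ y ⁆ ∪ targets ∣ ≤ suc ∣ sources ∣
  size′ = begin
    ∣ ⁅ y ⁆ ∪ targets ∣     ≤⟨ ∣p∪q∣≤∣p∣+∣q∣ ⁅ y ⁆ targets ⟩
    ∣ ⁅ y ⁆ ∣ + ∣ targets ∣ ≤⟨ +-mono-≤ (≤-reflexive (∣⁅x⁆∣≡1 y)) size ⟩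
    suc ∣ sources ∣         ∎
    where open ≤-Reasoning

  ∈targets′⁻ : ∀ {z} → z ∈ ⁅ y ⁆ ∪ targets → ∃[ x ] R x z
  ∈targets′⁻ z∈ with x∈p∪q⁻ ⁅ y ⁆ targets z∈
  ... | inj₂ z∈t = let x , Rxz = ∈targets⁻ z∈t in suc x , Rxz
  ... | inj₁ z∈y with refl ← x∈⁅y⁆⇒x≡y y z∈y = zero , R0y

  represent′ : ∀ {x z} → R x z → ∃[ w ] (w ∈ ⁅ y ⁆ ∪ targets × R x w)
  represent′ {zero}  _   = y , x∈p∪q⁺ (inj₁ (x∈⁅x⁆ y)) , R0y
  represent′ {suc x} Rxz = let w , w∈t , Rxw = represent Rxz in w , x∈p∪q⁺ (inj₂ w∈t) , Rxw

mainTheorem3 : (G : Digraph) → let open Digraph G in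
    Sourceless →
    (∃[ Q ] IsGoodQuasiKernel Q) →
    ∃[ Q ] (IsQuasiKernel Q × 2 * ∣ Q ∣ ≤ order)
mainTheorem3 G _ (Q , goodQ) = Q′ , isQuasiKernel′ , 2∣Q′∣≤order
  where
  open Digraph G
  open IsGoodQuasiKernel goodQ
  open IsQuasiKernel isQuasiKernel
  -- The relation runs against the arcs, from a vertex to its in-neighbours in `Q`, so that the
  -- representatives chosen lie in `Q` and the vertices represented in Γ⁺(Q).
  open Representatives
    (representatives {R = λ v u → u ∈ Q × u ⟶ v} λ v u → u ∈? Q ×-dec v ∈? out u)
    renaming (sources to N; targets to Q′)

  Q′⊆Q : Q′ ⊆ Q
  Q′⊆Q u∈Q′ = let _ , u∈Q , _ = ∈targets⁻ u∈Q′ in u∈Q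

  Γ⁺Q⊆Γ⁺Q′ : ∀ {v} → Γ⁺ ⟦ Q ⟧ v → Γ⁺ ⟦ Q′ ⟧ v
  Γ⁺Q⊆Γ⁺Q′ (_ , u⟶v) = let u′ , u′∈Q′ , _ , u′⟶v = represent u⟶v in u′ , u′∈Q′ , u′⟶v

  Γ⁺Γ⁺Q⊆Γ₂⁺Q′ : ∀ {v} → Γ⁺ (Γ⁺ ⟦ Q ⟧) v → Γ₂⁺ ⟦ Q′ ⟧ v
  Γ⁺Γ⁺Q⊆Γ₂⁺Q′ (w , w∈Γ⁺Q , w⟶v) = inj₂ (inj₂ (w , Γ⁺Q⊆Γ⁺Q′ w∈Γ⁺Q , w⟶v))

  -- Only the vertices of `Q` dropped from `Q′` could lose their cover, since both sets have the
  -- same out-neighbours. Goodness reaches these in two steps instead.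
  Γ₂⁺Q⊆Γ₂⁺Q′ : ∀ {v} → Γ₂⁺ ⟦ Q ⟧ v → Γ₂⁺ ⟦ Q′ ⟧ v
  Γ₂⁺Q⊆Γ₂⁺Q′ (inj₁ v∈Q)            = Γ⁺Γ⁺Q⊆Γ₂⁺Q′ (good v∈Q)
  Γ₂⁺Q⊆Γ₂⁺Q′ (inj₂ (inj₁ v∈Γ⁺Q))   = inj₂ (inj₁ (Γ⁺Q⊆Γ⁺Q′ v∈Γ⁺Q))
  Γ₂⁺Q⊆Γ₂⁺Q′ (inj₂ (inj₂ v∈Γ⁺Γ⁺Q)) = Γ⁺Γ⁺Q⊆Γ₂⁺Q′ v∈Γ⁺Γ⁺Q

  isQuasiKernel′ : IsQuasiKernel Q′
  isQuasiKernel′ = record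
    { independent = λ u∈Q′ v∈Q′ → independent (Q′⊆Q u∈Q′) (Q′⊆Q v∈Q′)
    ; covers      = (λ _ → tt) , λ _ → Γ₂⁺Q⊆Γ₂⁺Q′ (proj₂ covers tt)
    }

  2∣Q′∣≤order : 2 * ∣ Q′ ∣ ≤ order
  2∣Q′∣≤order = begin
    2 * ∣ Q′ ∣      ≡⟨ cong (∣ Q′ ∣ +_) (+-identityʳ ∣ Q′ ∣) ⟩
    -- The two copies are bounded differently: one by inclusion in `Q`, the other by the number of
    -- vertices represented.
    ∣ Q′ ∣ + ∣ Q′ ∣ ≤⟨ +-mono-≤ (p⊆q⇒∣p∣≤∣q∣ Q′⊆Q) size ⟩
    -- A common vertex would be the head of an arc with both ends in `Q`.
    ∣ Q ∣ + ∣ N ∣   ≤⟨ disjoint⇒∣p∣+∣q∣≤n (λ v∈Q v∈N →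
                         let _ , u∈Q , u⟶v = ∈sources⁻ v∈N in independent u∈Q v∈Q u⟶v) ⟩
    order           ∎
    where open ≤-Reasoning
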